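{- For all integers $n\geq1$ and all $i,j\in\mathbb N$ the following polynomial identities hold: \begin{align*} U_{n+i}U_{n+j}-U_{n-1}U_{n+1+i+j}&=U_iU_j,\\ T_{n+i}T_{n+j}-T_{n-1}T_{n+1+i+j}&=(1-x^2)U_iU_j,\\ T_{n+i}U_{n+j}-U_{n-1}T_{n+1+i+j}&=T_iU_j,\\ T_{n+i}U_{n+j}-T_{n-1}U_{n+1+i+j}&=-U_iT_{j+2},\\ T_{n+i}T_{n+j}-(x^2-1)U_{n-1}U_{n-1+i+j}&=T_iT_j. \end{align*}
   Context: $T_n=T_n(x)$ and $U_n=U_n(x)$ denote the Chebyshev polynomials of the first and second kind, defined by $T_0=1$, $T_1=x$, $T_{n+1}=2xT_n-T_{n-1}$ and $U_0=1$, $U_1=2x$, $U_{n+1}=2xU_n-U_{n-1}$ for $n\geq1$. -}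

module Defs where

open import Algebra.Bundles using (CommutativeRing)
open import Data.List.Base using (List; []; _∷_; map)
open import Data.Nat.Base using (ℕ; zero; suc)
open import Level using (Level)

module Polynomials {c ℓ : Level} (R : CommutativeRing c ℓ) where

  open CommutativeRing R

  -- R[x]: the list a₀ ∷ a₁ ∷ … ∷ aₙ ∷ [] stands for a₀ + a₁x + … + aₙxⁿ.
  -- Trailing zeros are allowed, so representations are not unique and
  -- equality of polynomials is _≋_, not _≡_.
  Poly : Set c
  Poly = List Carrier

  coeff : Poly → ℕ → Carrier
  coeff []      _       = 0#
  coeff (a ∷ p) zero    = a
  coeff (a ∷ p) (suc k) = coeff p k

  infix  4 _≋_
  infixl 6 _⊕_ _⊖_
  infixl 7 _⊗_

  _≋_ : Poly → Poly → Set ℓ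
  p ≋ q = ∀ k → coeff p k ≈ coeff q k

  _⊕_ : Poly → Poly → Poly
  []      ⊕ q       = q
  (a ∷ p) ⊕ []      = a ∷ p
  (a ∷ p) ⊕ (b ∷ q) = (a + b) ∷ (p ⊕ q)

  infix  8 ⊝_

  ⊝_ : Poly → Poly
  ⊝ p = map (-_) p

  _⊖_ : Poly → Poly → Poly
  p ⊖ q = p ⊕ (⊝ q)

  -- (a + x p) q = a q + x (p q)
  _⊗_ : Poly → Poly → Poly
  []      ⊗ q = []
  (a ∷ p) ⊗ q = map (a *_) q ⊕ (0# ∷ (p ⊗ q))

  𝟙 : Poly
  𝟙 = 1# ∷ []

  X : Poly
  X = 0# ∷ 1# ∷ []

  2X : Poly
  2X = (𝟙 ⊕ 𝟙) ⊗ X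

  T : ℕ → Poly
  T zero          = 𝟙
  T (suc zero)    = X
  T (suc (suc n)) = 2X ⊗ T (suc n) ⊖ T n

  U : ℕ → Poly
  U zero          = 𝟙
  U (suc zero)    = 2X
  U (suc (suc n)) = 2X ⊗ U (suc n) ⊖ U n

{-# OPTIONS --safe #-}

-- The casoratian f(a) g(b+1) − f(a+1) g(b) of two solutions of f(n+2) = 2x f(n+1) − f(n)
-- is invariant under (a, b) ↦ (a+1, b+1), and f(a) g(b+s+1) − f(a+s+1) g(b) is U(s) times
-- it. This evaluates the left-hand sides of the first four identities as U(j) (or U(i))
-- times a casoratian at b = 0. For the fifth, f(p+1) g(q+1) − f(p) g(q) depends only on
-- p + q, so that both products on the left change by the same amount when n increases.
module Submission where

open import Defs
open import Algebra.Bundles using (CommutativeRing)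
open import Algebra.Properties.AbelianGroup using (⁻¹-∙-comm)
import Algebra.Properties.CommutativeSemigroup as CommutativeSemigroupProperties
import Algebra.Properties.Group as GroupProperties
import Algebra.Properties.Ring as RingProperties
import Algebra.Properties.Semiring.Mult.TCOptimised as Mult
import Algebra.Solver.Ring as RingSolver
open import Algebra.Solver.Ring.AlmostCommutativeRing
  using (fromCommutativeRing; _-Raw-AlmostCommutative⟶_)
open import Algebra.Structures using (IsCommutativeRing)
open import Data.Integer.Base as ℤ using (ℤ; +_; +[1+_]; -[1+_]; +0; _◃_; sign; ∣_∣)
import Data.Integer.Properties as ℤ
open import Data.List.Base using ([]; _∷_; map)
import Data.Maybe.Base as Maybe
open import Data.Nat.Base as ℕ using (ℕ; zero; suc; _+_; _∸_; _≤_)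
import Data.Nat.Properties as ℕ
open import Data.Nat.Solver using (module +-*-Solver)
open import Data.Product using (_×_; _,_)
open import Data.Sign.Base as Sign using (Sign)
open import Level using (Level)
open import Relation.Binary.Consequences using (dec⇒weaklyDec)
open import Relation.Binary.PropositionalEquality as ≡ using (_≡_)
import Relation.Binary.Reasoning.Setoid as SetoidReasoning

-- Equality in R is undecidable, so a solver with coefficients in R could not cancel
-- terms; integer coefficients can be compared.
module IntegerSolver {c ℓ} (R : CommutativeRing c ℓ) where

  open CommutativeRing R hiding (zero) renaming (_+_ to _⊹_)
  open CommutativeSemigroupProperties +-commutativeSemigroup using (interchange)
  open GroupProperties +-group using (ε⁻¹≈ε; ⁻¹-involutive)
  open RingProperties ring using (-‿distribˡ-*; -‿distribʳ-*)
  open Mult semiring using (1+×; ×-homo-+; ×1-homo-*) renaming (_×_ to _·_)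
  open SetoidReasoning setoid

  -- The canonical homomorphism from the integers to a commutative ring.

  fromℤ : ℤ → Carrier
  fromℤ (+ n)    = n · 1#
  fromℤ -[1+ n ] = - (suc n · 1#)

  -- Cancelling a common successor is undone in the ring by adding `1# - 1#` and regrouping. Both
  -- mixed-sign cases of additivity reduce to this.
  fromℤ-⊖ : ∀ m n → fromℤ (m ℤ.⊖ n) ≈ m · 1# - n · 1#
  fromℤ-⊖ zero    zero    = sym (-‿inverseʳ 0#)
  fromℤ-⊖ zero    (suc n) = sym (+-identityˡ _)
  fromℤ-⊖ (suc m) zero    = sym (trans (+-congˡ ε⁻¹≈ε) (+-identityʳ _))
  fromℤ-⊖ (suc m) (suc n) = begin
    fromℤ (suc m ℤ.⊖ suc n)                    ≡⟨ ≡.cong fromℤ (ℤ.[1+m]⊖[1+n]≡m⊖n m n) ⟩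
    fromℤ (m ℤ.⊖ n)                            ≈⟨ fromℤ-⊖ m n ⟩
    m · 1# - n · 1#                          ≈⟨ +-identityˡ _ ⟨
    0# ⊹ (m · 1# - n · 1#)                   ≈⟨ +-congʳ (-‿inverseʳ 1#) ⟨
    (1# - 1#) ⊹ (m · 1# - n · 1#)            ≈⟨ interchange _ _ _ _ ⟩
    (1# ⊹ m · 1#) ⊹ (- 1# - n · 1#)          ≈⟨ +-congˡ (⁻¹-∙-comm +-abelianGroup _ _) ⟩
    (1# ⊹ m · 1#) - (1# ⊹ n · 1#)            ≈⟨ +-cong (1+× m 1#) (-‿cong (1+× n 1#)) ⟨
    suc m · 1# - suc n · 1#                  ∎

  fromℤ-+ : ∀ i j → fromℤ (i ℤ.+ j) ≈ fromℤ i ⊹ fromℤ j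
  fromℤ-+ (+ m)    (+ n)    = ×-homo-+ 1# m n
  fromℤ-+ (+ m)    -[1+ n ] = fromℤ-⊖ m (suc n)
  fromℤ-+ -[1+ m ] (+ n)    = trans (fromℤ-⊖ n (suc m)) (+-comm _ _)
  fromℤ-+ -[1+ m ] -[1+ n ] = begin
    - (suc (suc (m + n)) · 1#)       ≡⟨ ≡.cong (λ k → - (suc k · 1#)) (ℕ.+-suc m n) ⟨
    - ((suc m + suc n) · 1#)         ≈⟨ -‿cong (×-homo-+ 1# (suc m) (suc n)) ⟩
    - (suc m · 1# ⊹ suc n · 1#)      ≈⟨ ⁻¹-∙-comm +-abelianGroup _ _ ⟨
    - (suc m · 1#) - suc n · 1#      ∎

  fromℤ-neg : ∀ i → fromℤ (ℤ.- i) ≈ - fromℤ i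
  fromℤ-neg +0       = sym ε⁻¹≈ε
  fromℤ-neg +[1+ n ] = refl
  fromℤ-neg -[1+ n ] = sym (⁻¹-involutive _)

  -- Integer multiplication is defined through sign and absolute value. Transporting signs to the
  -- ring separately splits multiplicativity of `fromℤ` into a rule for signs and a rule for natural
  -- multiples.
  signed : Sign → Carrier → Carrier
  signed Sign.+ a = a
  signed Sign.- a = - a

  signed-cong : ∀ s {a b} → a ≈ b → signed s a ≈ signed s b
  signed-cong Sign.+ a≈b = a≈b
  signed-cong Sign.- a≈b = -‿cong a≈b

  signed-* : ∀ s t a b → signed (s Sign.* t) (a * b) ≈ signed s a * signed t b
  signed-* Sign.+ Sign.+ a b = refl
  signed-* Sign.+ Sign.- a b = -‿distribʳ-* a b
  signed-* Sign.- Sign.+ a b = -‿distribˡ-* a b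
  signed-* Sign.- Sign.- a b = begin
    a * b          ≈⟨ ⁻¹-involutive _ ⟨
    - - (a * b)    ≈⟨ -‿cong (-‿distribˡ-* a b) ⟩
    - (- a * b)    ≈⟨ -‿distribʳ-* (- a) b ⟩
    - a * - b      ∎

  fromℤ-◃ : ∀ s n → fromℤ (s ◃ n) ≈ signed s (n · 1#)
  fromℤ-◃ Sign.+ zero    = refl
  fromℤ-◃ Sign.+ (suc n) = refl
  fromℤ-◃ Sign.- zero    = sym ε⁻¹≈ε
  fromℤ-◃ Sign.- (suc n) = refl

  fromℤ-sign-abs : ∀ i → fromℤ i ≈ signed (sign i) (∣ i ∣ · 1#)
  fromℤ-sign-abs (+ n)    = refl
  fromℤ-sign-abs -[1+ n ] = refl

  fromℤ-* : ∀ i j → fromℤ (i ℤ.* j) ≈ fromℤ i * fromℤ j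
  fromℤ-* i j = begin
    fromℤ (i ℤ.* j)
      ≈⟨ fromℤ-◃ s (∣ i ∣ ℕ.* ∣ j ∣) ⟩
    signed s ((∣ i ∣ ℕ.* ∣ j ∣) · 1#)
      ≈⟨ signed-cong s (×1-homo-* ∣ i ∣ ∣ j ∣) ⟩
    signed s (∣ i ∣ · 1# * ∣ j ∣ · 1#)
      ≈⟨ signed-* (sign i) (sign j) _ _ ⟩
    signed (sign i) (∣ i ∣ · 1#) * signed (sign j) (∣ j ∣ · 1#)
      ≈⟨ *-cong (fromℤ-sign-abs i) (fromℤ-sign-abs j) ⟨
    fromℤ i * fromℤ j ∎
    where s = sign i Sign.* sign j

  fromℤ-homomorphism : ℤ.+-*-rawRing -Raw-AlmostCommutative⟶ fromCommutativeRing R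
  fromℤ-homomorphism = record
    { ⟦_⟧    = fromℤ
    ; +-homo = fromℤ-+
    ; *-homo = fromℤ-*
    ; -‿homo = fromℤ-neg
    ; 0-homo = refl
    -- The optimised multiple `1 · a` reduces to `a` itself, with no summand `0#`, so the solver's
    -- constant one is literally `1#`.
    ; 1-homo = refl
    }

  open RingSolver ℤ.+-*-rawRing (fromCommutativeRing R) fromℤ-homomorphism
    (λ i j → Maybe.map (λ i≡j → reflexive (≡.cong fromℤ i≡j)) (dec⇒weaklyDec ℤ._≟_ i j))
    public using (solve; con; _:+_; _:*_; _:-_; :-_; _:=_)

-- Coefficient lists form a commutative ring under coefficientwise equality.

module PolynomialRing {c ℓ} (R : CommutativeRing c ℓ) where

  open CommutativeRing R hiding (zero) renaming (_+_ to _⊹_)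
  open CommutativeSemigroupProperties +-commutativeSemigroup using (interchange; x∙yz≈y∙xz)
  open GroupProperties +-group using (ε⁻¹≈ε)
  open Polynomials R
  open SetoidReasoning setoid

  coeff-⊕ : ∀ p q k → coeff (p ⊕ q) k ≈ coeff p k ⊹ coeff q k
  coeff-⊕ []      q       k       = sym (+-identityˡ _)
  coeff-⊕ (a ∷ p) []      k       = sym (+-identityʳ _)
  coeff-⊕ (a ∷ p) (b ∷ q) zero    = refl
  coeff-⊕ (a ∷ p) (b ∷ q) (suc k) = coeff-⊕ p q k

  coeff-scale : ∀ a p k → coeff (map (a *_) p) k ≈ a * coeff p k
  coeff-scale a []      k       = sym (zeroʳ a)
  coeff-scale a (b ∷ p) zero    = refl
  coeff-scale a (b ∷ p) (suc k) = coeff-scale a p k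

  coeff-⊝ : ∀ p k → coeff (⊝ p) k ≈ - coeff p k
  coeff-⊝ []      k       = sym ε⁻¹≈ε
  coeff-⊝ (a ∷ p) zero    = refl
  coeff-⊝ (a ∷ p) (suc k) = coeff-⊝ p k

  -- The polynomial is an explicit argument because `_≋_` unfolds to a statement about coefficients,
  -- from which the lists cannot be inferred. For the same reason many implicit arguments below are
  -- supplied by hand.
  ≋-refl : ∀ p → p ≋ p
  ≋-refl p k = refl

  0∷-cong : ∀ p q → p ≋ q → 0# ∷ p ≋ 0# ∷ q
  0∷-cong p q p≋q zero    = refl
  0∷-cong p q p≋q (suc k) = p≋q k

  0∷[]≋[] : 0# ∷ [] ≋ []
  0∷[]≋[] zero    = refl
  0∷[]≋[] (suc k) = refl

  scale-cong : ∀ a p q → p ≋ q → map (a *_) p ≋ map (a *_) q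
  scale-cong a p q p≋q k =
    trans (coeff-scale a p k) (trans (*-congˡ (p≋q k)) (sym (coeff-scale a q k)))

  ⊝-cong : ∀ {p q} → p ≋ q → ⊝ p ≋ ⊝ q
  ⊝-cong {p} {q} p≋q k =
    trans (coeff-⊝ p k) (trans (-‿cong (p≋q k)) (sym (coeff-⊝ q k)))

  ⊕-cong : ∀ {p p′ q q′} → p ≋ p′ → q ≋ q′ → p ⊕ q ≋ p′ ⊕ q′
  ⊕-cong {p} {p′} {q} {q′} p≋p′ q≋q′ k =
    trans (coeff-⊕ p q k) (trans (+-cong (p≋p′ k) (q≋q′ k)) (sym (coeff-⊕ p′ q′ k)))

  ⊕-assoc : ∀ p q r → (p ⊕ q) ⊕ r ≋ p ⊕ (q ⊕ r)
  ⊕-assoc p q r k = begin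
    coeff ((p ⊕ q) ⊕ r) k                 ≈⟨ coeff-⊕ (p ⊕ q) r k ⟩
    coeff (p ⊕ q) k ⊹ coeff r k           ≈⟨ +-congʳ (coeff-⊕ p q k) ⟩
    (coeff p k ⊹ coeff q k) ⊹ coeff r k   ≈⟨ +-assoc _ _ _ ⟩
    coeff p k ⊹ (coeff q k ⊹ coeff r k)   ≈⟨ +-congˡ (coeff-⊕ q r k) ⟨
    coeff p k ⊹ coeff (q ⊕ r) k           ≈⟨ coeff-⊕ p (q ⊕ r) k ⟨
    coeff (p ⊕ (q ⊕ r)) k                 ∎

  ⊕-comm : ∀ p q → p ⊕ q ≋ q ⊕ p
  ⊕-comm p q k = trans (coeff-⊕ p q k) (trans (+-comm _ _) (sym (coeff-⊕ q p k)))

  ⊕-identityʳ : ∀ p → p ⊕ [] ≋ p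
  ⊕-identityʳ p = ⊕-comm p []

  ⊝-inverseʳ : ∀ p → p ⊖ p ≋ []
  ⊝-inverseʳ p k = begin
    coeff (p ⊖ p) k             ≈⟨ coeff-⊕ p (⊝ p) k ⟩
    coeff p k ⊹ coeff (⊝ p) k   ≈⟨ +-congˡ (coeff-⊝ p k) ⟩
    coeff p k - coeff p k       ≈⟨ -‿inverseʳ _ ⟩
    0#                          ∎

  ⊝-inverseˡ : ∀ p → ⊝ p ⊕ p ≋ []
  ⊝-inverseˡ p k = trans (⊕-comm (⊝ p) p k) (⊝-inverseʳ p k)

  -- This and the next formula peel one coefficient off the first factor, so that ring laws for
  -- lists reduce to laws of `R` in each degree.
  coeff-∷-⊗-zero : ∀ a p q → coeff ((a ∷ p) ⊗ q) zero ≈ a * coeff q zero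
  coeff-∷-⊗-zero a p q =
    trans (coeff-⊕ (map (a *_) q) _ zero) (trans (+-identityʳ _) (coeff-scale a q zero))

  coeff-∷-⊗-suc : ∀ a p q k →
    coeff ((a ∷ p) ⊗ q) (suc k) ≈ a * coeff q (suc k) ⊹ coeff (p ⊗ q) k
  coeff-∷-⊗-suc a p q k =
    trans (coeff-⊕ (map (a *_) q) _ (suc k)) (+-congʳ (coeff-scale a q (suc k)))

  ⊗-congˡ : ∀ p {q r} → q ≋ r → p ⊗ q ≋ p ⊗ r
  ⊗-congˡ []      q≋r k = refl
  ⊗-congˡ (a ∷ p) {q} {r} q≋r =
    ⊕-cong {map (a *_) q} {map (a *_) r} {0# ∷ (p ⊗ q)} {0# ∷ (p ⊗ r)}
      (scale-cong a q r q≋r) (0∷-cong (p ⊗ q) (p ⊗ r) (⊗-congˡ p {q} {r} q≋r))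

  ⊗-zeroʳ : ∀ p → p ⊗ [] ≋ []
  ⊗-zeroʳ []      k       = refl
  ⊗-zeroʳ (a ∷ p) zero    = refl
  ⊗-zeroʳ (a ∷ p) (suc k) = ⊗-zeroʳ p k

  -- The mirror image of the defining clause of `_⊗_`, with the second factor split. It is the
  -- inductive step of commutativity.
  ⊗-∷ : ∀ p b q → p ⊗ (b ∷ q) ≋ map (b *_) p ⊕ (0# ∷ (p ⊗ q))
  ⊗-∷ []      b q zero    = refl
  ⊗-∷ []      b q (suc k) = refl
  ⊗-∷ (a ∷ p) b q zero    = +-congʳ (*-comm a b)
  ⊗-∷ (a ∷ p) b q (suc k) = begin
    coeff (map (a *_) q ⊕ p ⊗ (b ∷ q)) k
      ≈⟨ coeff-⊕ (map (a *_) q) _ k ⟩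
    coeff (map (a *_) q) k ⊹ coeff (p ⊗ (b ∷ q)) k
      ≈⟨ +-congˡ (⊗-∷ p b q k) ⟩
    coeff (map (a *_) q) k ⊹ coeff (map (b *_) p ⊕ (0# ∷ (p ⊗ q))) k
      ≈⟨ +-congˡ (coeff-⊕ (map (b *_) p) _ k) ⟩
    coeff (map (a *_) q) k ⊹ (coeff (map (b *_) p) k ⊹ coeff (0# ∷ (p ⊗ q)) k)
      ≈⟨ x∙yz≈y∙xz _ _ _ ⟩
    coeff (map (b *_) p) k ⊹ (coeff (map (a *_) q) k ⊹ coeff (0# ∷ (p ⊗ q)) k)
      ≈⟨ +-congˡ (coeff-⊕ (map (a *_) q) _ k) ⟨
    coeff (map (b *_) p) k ⊹ coeff ((a ∷ p) ⊗ q) k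
      ≈⟨ coeff-⊕ (map (b *_) p) _ k ⟨
    coeff (map (b *_) p ⊕ (a ∷ p) ⊗ q) k ∎

  ⊗-comm : ∀ p q → p ⊗ q ≋ q ⊗ p
  ⊗-comm []      q k = sym (⊗-zeroʳ q k)
  ⊗-comm (a ∷ p) q k = begin
    coeff (map (a *_) q ⊕ (0# ∷ (p ⊗ q))) k
      ≈⟨ ⊕-cong {map (a *_) q} {map (a *_) q} {0# ∷ (p ⊗ q)} {0# ∷ (q ⊗ p)}
           (≋-refl (map (a *_) q)) (0∷-cong (p ⊗ q) (q ⊗ p) (⊗-comm p q)) k ⟩
    coeff (map (a *_) q ⊕ (0# ∷ (q ⊗ p))) k
      ≈⟨ ⊗-∷ q a p k ⟨
    coeff (q ⊗ (a ∷ p)) k ∎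

  -- Equal polynomials may be lists of different lengths, so recursion on the first factor does not
  -- directly compare two of them. Commutativity moves the change to the second factor.
  ⊗-cong : ∀ {p p′ q q′} → p ≋ p′ → q ≋ q′ → p ⊗ q ≋ p′ ⊗ q′
  ⊗-cong {p} {p′} {q} {q′} p≋p′ q≋q′ k = begin
    coeff (p ⊗ q) k     ≈⟨ ⊗-congˡ p {q} {q′} q≋q′ k ⟩
    coeff (p ⊗ q′) k    ≈⟨ ⊗-comm p q′ k ⟩
    coeff (q′ ⊗ p) k    ≈⟨ ⊗-congˡ q′ {p} {p′} p≋p′ k ⟩
    coeff (q′ ⊗ p′) k   ≈⟨ ⊗-comm q′ p′ k ⟩
    coeff (p′ ⊗ q′) k   ∎

  ⊗-distribˡ-⊕ : ∀ p q r → p ⊗ (q ⊕ r) ≋ p ⊗ q ⊕ p ⊗ r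
  ⊗-distribˡ-⊕ []      q r k = refl
  ⊗-distribˡ-⊕ (a ∷ p) q r zero = begin
    coeff ((a ∷ p) ⊗ (q ⊕ r)) 0                     ≈⟨ coeff-∷-⊗-zero a p (q ⊕ r) ⟩
    a * coeff (q ⊕ r) 0                             ≈⟨ *-congˡ (coeff-⊕ q r 0) ⟩
    a * (coeff q 0 ⊹ coeff r 0)                     ≈⟨ distribˡ a _ _ ⟩
    a * coeff q 0 ⊹ a * coeff r 0                   ≈⟨ +-cong (coeff-∷-⊗-zero a p q) (coeff-∷-⊗-zero a p r) ⟨
    coeff ((a ∷ p) ⊗ q) 0 ⊹ coeff ((a ∷ p) ⊗ r) 0   ≈⟨ coeff-⊕ ((a ∷ p) ⊗ q) _ 0 ⟨
    coeff ((a ∷ p) ⊗ q ⊕ (a ∷ p) ⊗ r) 0             ∎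
  ⊗-distribˡ-⊕ (a ∷ p) q r (suc k) = begin
    coeff ((a ∷ p) ⊗ (q ⊕ r)) (suc k)
      ≈⟨ coeff-∷-⊗-suc a p (q ⊕ r) k ⟩
    a * coeff (q ⊕ r) (suc k) ⊹ coeff (p ⊗ (q ⊕ r)) k
      ≈⟨ +-cong (*-congˡ (coeff-⊕ q r (suc k))) (⊗-distribˡ-⊕ p q r k) ⟩
    a * (coeff q (suc k) ⊹ coeff r (suc k)) ⊹ coeff (p ⊗ q ⊕ p ⊗ r) k
      ≈⟨ +-cong (distribˡ a _ _) (coeff-⊕ (p ⊗ q) _ k) ⟩
    (a * coeff q (suc k) ⊹ a * coeff r (suc k)) ⊹ (coeff (p ⊗ q) k ⊹ coeff (p ⊗ r) k)
      ≈⟨ interchange _ _ _ _ ⟩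
    (a * coeff q (suc k) ⊹ coeff (p ⊗ q) k) ⊹ (a * coeff r (suc k) ⊹ coeff (p ⊗ r) k)
      ≈⟨ +-cong (coeff-∷-⊗-suc a p q k) (coeff-∷-⊗-suc a p r k) ⟨
    coeff ((a ∷ p) ⊗ q) (suc k) ⊹ coeff ((a ∷ p) ⊗ r) (suc k)
      ≈⟨ coeff-⊕ ((a ∷ p) ⊗ q) _ (suc k) ⟨
    coeff ((a ∷ p) ⊗ q ⊕ (a ∷ p) ⊗ r) (suc k) ∎

  ⊗-distribʳ-⊕ : ∀ p q r → (q ⊕ r) ⊗ p ≋ q ⊗ p ⊕ r ⊗ p
  ⊗-distribʳ-⊕ p q r k = begin
    coeff ((q ⊕ r) ⊗ p) k     ≈⟨ ⊗-comm (q ⊕ r) p k ⟩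
    coeff (p ⊗ (q ⊕ r)) k     ≈⟨ ⊗-distribˡ-⊕ p q r k ⟩
    coeff (p ⊗ q ⊕ p ⊗ r) k   ≈⟨ ⊕-cong {p ⊗ q} {q ⊗ p} {p ⊗ r} {r ⊗ p} (⊗-comm p q) (⊗-comm p r) k ⟩
    coeff (q ⊗ p ⊕ r ⊗ p) k   ∎

  -- Together with `0∷-⊗` this makes multiplication by a fixed polynomial compatible with scalars
  -- and with multiplication by x, the two ingredients of a product that associativity has to move.
  scale-⊗ : ∀ a p q → map (a *_) p ⊗ q ≋ map (a *_) (p ⊗ q)
  scale-⊗ a []      q k = refl
  scale-⊗ a (b ∷ p) q zero = begin
    coeff (map (a *_) (b ∷ p) ⊗ q) 0     ≈⟨ coeff-∷-⊗-zero (a * b) (map (a *_) p) q ⟩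
    (a * b) * coeff q 0                  ≈⟨ *-assoc a b _ ⟩
    a * (b * coeff q 0)                  ≈⟨ *-congˡ (coeff-∷-⊗-zero b p q) ⟨
    a * coeff ((b ∷ p) ⊗ q) 0            ≈⟨ coeff-scale a ((b ∷ p) ⊗ q) 0 ⟨
    coeff (map (a *_) ((b ∷ p) ⊗ q)) 0   ∎
  scale-⊗ a (b ∷ p) q (suc k) = begin
    coeff (map (a *_) (b ∷ p) ⊗ q) (suc k)
      ≈⟨ coeff-∷-⊗-suc (a * b) (map (a *_) p) q k ⟩
    (a * b) * coeff q (suc k) ⊹ coeff (map (a *_) p ⊗ q) k
      ≈⟨ +-cong (*-assoc a b _) (trans (scale-⊗ a p q k) (coeff-scale a (p ⊗ q) k)) ⟩
    a * (b * coeff q (suc k)) ⊹ a * coeff (p ⊗ q) k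
      ≈⟨ distribˡ a _ _ ⟨
    a * (b * coeff q (suc k) ⊹ coeff (p ⊗ q) k)
      ≈⟨ *-congˡ (coeff-∷-⊗-suc b p q k) ⟨
    a * coeff ((b ∷ p) ⊗ q) (suc k)
      ≈⟨ coeff-scale a ((b ∷ p) ⊗ q) (suc k) ⟨
    coeff (map (a *_) ((b ∷ p) ⊗ q)) (suc k) ∎

  0∷-⊗ : ∀ p q → (0# ∷ p) ⊗ q ≋ 0# ∷ (p ⊗ q)
  0∷-⊗ p q zero    = trans (coeff-∷-⊗-zero 0# p q) (zeroˡ _)
  0∷-⊗ p q (suc k) = trans (coeff-∷-⊗-suc 0# p q k) (trans (+-congʳ (zeroˡ _)) (+-identityˡ _))

  ⊗-assoc : ∀ p q r → (p ⊗ q) ⊗ r ≋ p ⊗ (q ⊗ r)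
  ⊗-assoc []      q r k = refl
  ⊗-assoc (a ∷ p) q r k = begin
    coeff ((map (a *_) q ⊕ (0# ∷ (p ⊗ q))) ⊗ r) k
      ≈⟨ ⊗-distribʳ-⊕ r (map (a *_) q) (0# ∷ (p ⊗ q)) k ⟩
    coeff (map (a *_) q ⊗ r ⊕ (0# ∷ (p ⊗ q)) ⊗ r) k
      ≈⟨ ⊕-cong {map (a *_) q ⊗ r} {map (a *_) (q ⊗ r)}
           {(0# ∷ (p ⊗ q)) ⊗ r} {0# ∷ ((p ⊗ q) ⊗ r)}
           (scale-⊗ a q r) (0∷-⊗ (p ⊗ q) r) k ⟩
    coeff (map (a *_) (q ⊗ r) ⊕ (0# ∷ ((p ⊗ q) ⊗ r))) k
      ≈⟨ ⊕-cong {map (a *_) (q ⊗ r)} {map (a *_) (q ⊗ r)}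
           {0# ∷ ((p ⊗ q) ⊗ r)} {0# ∷ (p ⊗ (q ⊗ r))}
           (≋-refl (map (a *_) (q ⊗ r)))
           (0∷-cong ((p ⊗ q) ⊗ r) (p ⊗ (q ⊗ r)) (⊗-assoc p q r)) k ⟩
    coeff (map (a *_) (q ⊗ r) ⊕ (0# ∷ (p ⊗ (q ⊗ r)))) k ∎

  ⊗-identityˡ : ∀ p → 𝟙 ⊗ p ≋ p
  ⊗-identityˡ p k = begin
    coeff (map (1# *_) p ⊕ (0# ∷ [])) k        ≈⟨ coeff-⊕ (map (1# *_) p) _ k ⟩
    coeff (map (1# *_) p) k ⊹ coeff (0# ∷ []) k ≈⟨ +-cong (coeff-scale 1# p k) (0∷[]≋[] k) ⟩
    1# * coeff p k ⊹ 0#                        ≈⟨ +-identityʳ _ ⟩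
    1# * coeff p k                             ≈⟨ *-identityˡ _ ⟩
    coeff p k                                  ∎

  ⊗-identityʳ : ∀ p → p ⊗ 𝟙 ≋ p
  ⊗-identityʳ p k = trans (⊗-comm p 𝟙 k) (⊗-identityˡ p k)

  ⊕-⊗-isCommutativeRing : IsCommutativeRing _≋_ _⊕_ _⊗_ ⊝_ [] 𝟙
  ⊕-⊗-isCommutativeRing = record
    { isRing = record
      { +-isAbelianGroup = record
        { isGroup = record
          { isMonoid = record
            { isSemigroup = record
              { isMagma = record
                { isEquivalence = record
                  { refl  = λ {p} → ≋-refl p
                  ; sym   = λ p≋q k → sym (p≋q k)
                  ; trans = λ p≋q q≋r k → trans (p≋q k) (q≋r k)
                  }
                ; ∙-cong = λ {p} {p′} {q} {q′} → ⊕-cong {p} {p′} {q} {q′}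
                }
              ; assoc = ⊕-assoc
              }
            ; identity = ≋-refl , ⊕-identityʳ
            }
          ; inverse = ⊝-inverseˡ , ⊝-inverseʳ
          ; ⁻¹-cong = λ {p} {q} → ⊝-cong {p} {q}
          }
        ; comm = ⊕-comm
        }
      ; *-cong     = λ {p} {p′} {q} {q′} → ⊗-cong {p} {p′} {q} {q′}
      ; *-assoc    = ⊗-assoc
      ; *-identity = ⊗-identityˡ , ⊗-identityʳ
      ; distrib    = ⊗-distribˡ-⊕ , ⊗-distribʳ-⊕
      }
    ; *-comm = ⊗-comm
    }

  ⊕-⊗-commutativeRing : CommutativeRing c ℓ
  ⊕-⊗-commutativeRing = record { isCommutativeRing = ⊕-⊗-isCommutativeRing }

-- Solutions of the Chebyshev recurrence in an arbitrary commutative ring.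

module ChebyshevRecurrence {c ℓ} (R : CommutativeRing c ℓ) (x : CommutativeRing.Carrier R) where

  open CommutativeRing R hiding (zero) renaming (_+_ to _⊹_)
  open IntegerSolver R using (solve; con; _:+_; _:*_; _:-_; :-_; _:=_)
  open SetoidReasoning setoid

  2x : Carrier
  2x = (1# ⊹ 1#) * x

  Solution : (ℕ → Carrier) → Set ℓ
  Solution f = ∀ n → f (2 + n) ≈ 2x * f (1 + n) - f n

  index : ∀ (f : ℕ → Carrier) {m n} → m ≡ n → f m ≈ f n
  index f m≡n = reflexive (≡.cong f m≡n)

  -‿cong₂ : ∀ {a b c d} → a ≈ b → c ≈ d → a - c ≈ b - d
  -‿cong₂ a≈b c≈d = +-cong a≈b (-‿cong c≈d)

  -- A second-order recurrence is determined by two initial values, so a linear identity between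
  -- solutions needs checking only at 0 and 1.
  Solution-unique : ∀ {f g} → Solution f → Solution g →
                    f 0 ≈ g 0 → f 1 ≈ g 1 → ∀ n → f n ≈ g n
  Solution-unique F G f₀ f₁ zero          = f₀
  Solution-unique F G f₀ f₁ (suc zero)    = f₁
  Solution-unique {f} {g} F G f₀ f₁ (suc (suc n)) = begin
    f (2 + n)              ≈⟨ F n ⟩
    2x * f (1 + n) - f n   ≈⟨ -‿cong₂ (*-congˡ (Solution-unique F G f₀ f₁ (suc n))) (Solution-unique F G f₀ f₁ n) ⟩
    2x * g (1 + n) - g n   ≈⟨ G n ⟨
    g (2 + n)              ∎

  Solution-combine : ∀ {f g} a b → Solution f → Solution g → Solution (λ n → a * f n ⊹ b * g n)
  Solution-combine {f} {g} a b F G n = begin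
    a * f (2 + n) ⊹ b * g (2 + n)
      ≈⟨ +-cong (*-congˡ (F n)) (*-congˡ (G n)) ⟩
    a * (2x * f (1 + n) - f n) ⊹ b * (2x * g (1 + n) - g n)
      ≈⟨ solve 7 (λ t a b f f′ g g′ →
           a :* (t :* f′ :- f) :+ b :* (t :* g′ :- g)
             := t :* (a :* f′ :+ b :* g′) :- (a :* f :+ b :* g))
           refl 2x a b (f n) (f (1 + n)) (g n) (g (1 + n)) ⟩
    2x * (a * f (1 + n) ⊹ b * g (1 + n)) - (a * f n ⊹ b * g n) ∎

  -- For `a = b` this is the Casorati determinant, the discrete Wronskian. Separate indices allow
  -- the two sequences to be read at different offsets.
  casoratian : (f g : ℕ → Carrier) → ℕ → ℕ → Carrier
  casoratian f g a b = f a * g (suc b) - f (suc a) * g b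

  module _ {f g : ℕ → Carrier} (F : Solution f) (G : Solution g) where

    -- Both rows of the determinant are advanced by the same transition matrix, whose determinant is
    -- 1 because `f n` enters the recurrence with coefficient -1.
    casoratian-shift : ∀ n a b → casoratian f g (n + a) (n + b) ≈ casoratian f g a b
    casoratian-shift zero    a b = refl
    casoratian-shift (suc n) a b = trans (begin
      f (1 + k) * g (2 + l) - f (2 + k) * g (1 + l)
        ≈⟨ -‿cong₂ (*-congˡ (G l)) (*-congʳ (F k)) ⟩
      f (1 + k) * (2x * g (1 + l) - g l) - (2x * f (1 + k) - f k) * g (1 + l)
        ≈⟨ solve 5 (λ t f f′ g g′ →
             f′ :* (t :* g′ :- g) :- (t :* f′ :- f) :* g′ := f :* g′ :- f′ :* g)
             refl 2x (f k) (f (1 + k)) (g l) (g (1 + l)) ⟩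
      f k * g (1 + l) - f (1 + k) * g l ∎) (casoratian-shift n a b)
      where
      k = n + a
      l = n + b

    -- Since (f(p+2) + f(p)) g(q+1) and f(p+1) (g(q+2) + g(q)) both equal 2x f(p+1) g(q+1), a unit
    -- can be moved from `p` to `q` without changing the difference.
    diagonal-difference : ∀ p q →
      f (1 + p) * g (1 + q) - f p * g q ≈ f 1 * g (1 + (p + q)) - f 0 * g (p + q)
    diagonal-difference zero    q = refl
    diagonal-difference (suc p) q = begin
      f (2 + p) * g (1 + q) - f (1 + p) * g q
        ≈⟨ +-congʳ (*-congʳ (F p)) ⟩
      (2x * f (1 + p) - f p) * g (1 + q) - f (1 + p) * g q
        ≈⟨ solve 5 (λ t f f′ g g′ →
             (t :* f′ :- f) :* g′ :- f′ :* g := f′ :* (t :* g′ :- g) :- f :* g′)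
             refl 2x (f p) (f (1 + p)) (g q) (g (1 + q)) ⟩
      f (1 + p) * (2x * g (1 + q) - g q) - f p * g (1 + q)
        ≈⟨ +-congʳ (*-congˡ (G q)) ⟨
      f (1 + p) * g (2 + q) - f p * g (1 + q)
        ≈⟨ diagonal-difference p (1 + q) ⟩
      f 1 * g (1 + (p + suc q)) - f 0 * g (p + suc q)
        ≈⟨ index (λ k → f 1 * g (1 + k) - f 0 * g k) (ℕ.+-suc p q) ⟩
      f 1 * g (2 + (p + q)) - f 0 * g (1 + (p + q)) ∎

  -- The Chebyshev sequences, given only by their recurrence and initial values.

  module Identities {T U : ℕ → Carrier}
    (T-solution : Solution T) (T₀ : T 0 ≈ 1#) (T₁ : T 1 ≈ x)
    (U-solution : Solution U) (U₀ : U 0 ≈ 1#) (U₁ : U 1 ≈ 2x) where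

    T₂ : T 2 ≈ 2x * x - 1#
    T₂ = trans (T-solution 0) (-‿cong₂ (*-congˡ T₁) T₀)

    U₂ : U 2 ≈ 2x * 2x - 1#
    U₂ = trans (U-solution 0) (-‿cong₂ (*-congˡ U₁) U₀)

    -- With x = cos θ this is the addition formula for cos((n+1)θ - θ). Both sides solve the
    -- recurrence in `n`, so the values at 0 and 1 decide.
    T-in-U : ∀ n → T n - x * T (1 + n) ≈ (1# - x * x) * U n
    T-in-U n = trans
      (solve 3 (λ x a b → a :- x :* b := con (+ 1) :* a :+ (:- x) :* b) refl x _ _)
      (trans
        (Solution-unique
          (Solution-combine 1# (- x) T-solution (λ k → T-solution (1 + k)))
          -- The right side has a single term; a second copy of `U` with coefficient `0#` gives it
          -- the shape of a combination.
          (Solution-combine (1# - x * x) 0# U-solution U-solution)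
          (trans (+-cong (*-congˡ T₀) (*-congˡ T₁))
            (trans (solve 1 (λ x →
                con (+ 1) :* con (+ 1) :+ (:- x) :* x
                  := (con (+ 1) :- x :* x) :* con (+ 1) :+ con (+ 0) :* con (+ 1)) refl x)
              (sym (+-cong (*-congˡ U₀) (*-congˡ U₀)))))
          (trans (+-cong (*-congˡ T₁) (*-congˡ T₂))
            -- Here `2x` cannot stay an atom for the solver, since the identity depends on its being
            -- twice x.
            (trans (solve 1 (λ x → let 2X = (con (+ 1) :+ con (+ 1)) :* x in
                con (+ 1) :* x :+ (:- x) :* (2X :* x :- con (+ 1))
                  := (con (+ 1) :- x :* x) :* 2X :+ con (+ 0) :* 2X) refl x)
              (sym (+-cong (*-congˡ U₁) (*-congˡ U₁)))))
          n)
        (solve 2 (λ a b → a :* b :+ con (+ 0) :* b := a :* b) refl _ _))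

    -- The addition formula for sin((n+1)θ + θ), again decided by two initial values. It later
    -- eliminates a `U` in favour of a `T`.
    U-suc : ∀ n → U (1 + n) ≈ x * U n ⊹ 1# * T (1 + n)
    U-suc = Solution-unique (λ k → U-solution (1 + k))
      (Solution-combine x 1# U-solution (λ k → T-solution (1 + k)))
      (trans U₁ (trans
        (solve 1 (λ x → (con (+ 1) :+ con (+ 1)) :* x := x :* con (+ 1) :+ con (+ 1) :* x) refl x)
        (sym (+-cong (*-congˡ U₀) (*-congˡ T₁)))))
      (trans U₂ (trans
        (solve 1 (λ x → let 2X = (con (+ 1) :+ con (+ 1)) :* x in
          2X :* 2X :- con (+ 1) := x :* 2X :+ con (+ 1) :* (2X :* x :- con (+ 1))) refl x)
        (sym (+-cong (*-congˡ U₁) (*-congˡ T₂)))))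

    -- For fixed `a` and `b` the left side solves the recurrence in `s`. It starts with the
    -- casoratian and 2x times the casoratian, just as `U` starts with 1 and 2x.
    casoratian-jump : ∀ {f g} → Solution f → Solution g → ∀ a b s →
      f a * g (suc s + b) - f (suc s + a) * g b ≈ U s * casoratian f g a b
    casoratian-jump {f} {g} F G a b zero = sym (trans (*-congʳ U₀) (*-identityˡ _))
    casoratian-jump {f} {g} F G a b (suc zero) = begin
      f a * g (2 + b) - f (2 + a) * g b
        ≈⟨ -‿cong₂ (*-congˡ (G b)) (*-congʳ (F a)) ⟩
      f a * (2x * g (1 + b) - g b) - (2x * f (1 + a) - f a) * g b
        ≈⟨ solve 5 (λ t f f′ g g′ →
             f :* (t :* g′ :- g) :- (t :* f′ :- f) :* g := t :* (f :* g′ :- f′ :* g))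
             refl 2x (f a) (f (1 + a)) (g b) (g (1 + b)) ⟩
      2x * casoratian f g a b
        ≈⟨ *-congʳ U₁ ⟨
      U 1 * casoratian f g a b ∎
    casoratian-jump {f} {g} F G a b (suc (suc s)) = begin
      f a * g (3 + s + b) - f (3 + s + a) * g b
        ≈⟨ -‿cong₂ (*-congˡ (G (1 + s + b))) (*-congʳ (F (1 + s + a))) ⟩
      f a * (2x * g (2 + s + b) - g (1 + s + b)) - (2x * f (2 + s + a) - f (1 + s + a)) * g b
        ≈⟨ solve 7 (λ t f f′ f″ g g′ g″ →
             f :* (t :* g″ :- g′) :- (t :* f″ :- f′) :* g
               := t :* (f :* g″ :- f″ :* g) :- (f :* g′ :- f′ :* g))
             refl 2x (f a) (f (1 + s + a)) (f (2 + s + a)) (g b) (g (1 + s + b)) (g (2 + s + b)) ⟩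
      2x * (f a * g (2 + s + b) - f (2 + s + a) * g b) - (f a * g (1 + s + b) - f (1 + s + a) * g b)
        ≈⟨ -‿cong₂ (*-congˡ (casoratian-jump F G a b (suc s))) (casoratian-jump F G a b s) ⟩
      2x * (U (suc s) * w) - U s * w
        ≈⟨ solve 4 (λ t u v w → t :* (u :* w) :- v :* w := (t :* u :- v) :* w)
             refl 2x (U (suc s)) (U s) w ⟩
      (2x * U (suc s) - U s) * w
        ≈⟨ *-congʳ (U-solution s) ⟨
      U (2 + s) * w ∎
      where w = casoratian f g a b

    -- This is casoratian-jump at a = m + 1 + i, b = m, s = j, followed by a shift by m.
    product-difference : ∀ {f g} → Solution f → Solution g → ∀ m i j →
      f (suc m + i) * g (suc m + j) - g m * f (suc m + 1 + i + j)
        ≈ U j * (f (1 + i) * g 1 - f (2 + i) * g 0)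
    product-difference {f} {g} F G m i j = begin
      f (suc m + i) * g (suc m + j) - g m * f (suc m + 1 + i + j)
        ≈⟨ -‿cong₂
             (*-cong (index f (≡.sym (ℕ.+-suc m i))) (index g (≡.cong suc (ℕ.+-comm m j))))
             (trans (*-comm _ _) (*-cong (index f
               (N.solve 3 (λ m i j → N.con 1 N.:+ m N.:+ N.con 1 N.:+ i N.:+ j
                 N.:= N.con 1 N.:+ j N.:+ (m N.:+ (N.con 1 N.:+ i))) ≡.refl m i j))
               (index g (≡.sym (ℕ.+-identityʳ m))))) ⟩
      f (m + suc i) * g (suc j + m) - f (suc j + (m + suc i)) * g (m + 0)
        ≈⟨ +-congʳ (*-congˡ (index (λ k → g (suc j + k)) (≡.sym (ℕ.+-identityʳ m)))) ⟩
      f (m + suc i) * g (suc j + (m + 0)) - f (suc j + (m + suc i)) * g (m + 0)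
        ≈⟨ casoratian-jump F G (m + suc i) (m + 0) j ⟩
      U j * casoratian f g (m + suc i) (m + 0)
        ≈⟨ *-congˡ (casoratian-shift F G m (suc i) 0) ⟩
      U j * casoratian f g (suc i) 0 ∎
      where module N = +-*-Solver

    -- The five product identities, with `m` in the role of n - 1.

    UU-UU : ∀ m i j →
      U (suc m + i) * U (suc m + j) - U m * U (suc m + 1 + i + j) ≈ U i * U j
    UU-UU m i j = begin
      _ ≈⟨ product-difference U-solution U-solution m i j ⟩
      U j * (U (1 + i) * U 1 - U (2 + i) * U 0)
        -- The remaining factor is 2x U(i+1) - U(i+2), which the recurrence collapses to U(i).
        ≈⟨ *-congˡ (-‿cong₂ (*-congˡ U₁) (*-cong (U-solution i) U₀)) ⟩
      U j * (U (1 + i) * 2x - (2x * U (1 + i) - U i) * 1#)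
        ≈⟨ solve 4 (λ t u v w → w :* (v :* t :- (t :* v :- u) :* con (+ 1)) := u :* w)
             refl 2x (U i) (U (1 + i)) (U j) ⟩
      U i * U j ∎

    -- Here the casoratian at offset 0 is x T(i+1) - T(i+2) = T(i) - x T(i+1), which `T-in-U`
    -- evaluates.
    TT-TT : ∀ m i j →
      T (suc m + i) * T (suc m + j) - T m * T (suc m + 1 + i + j) ≈ (1# - x * x) * (U i * U j)
    TT-TT m i j = begin
      _ ≈⟨ product-difference T-solution T-solution m i j ⟩
      U j * (T (1 + i) * T 1 - T (2 + i) * T 0)
        ≈⟨ *-congˡ (-‿cong₂ (*-congˡ T₁) (*-cong (T-solution i) T₀)) ⟩
      U j * (T (1 + i) * x - (2x * T (1 + i) - T i) * 1#)
        ≈⟨ solve 4 (λ x u v w →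
             w :* (v :* x :- ((con (+ 1) :+ con (+ 1)) :* x :* v :- u) :* con (+ 1))
               := (u :- x :* v) :* w)
             refl x (T i) (T (1 + i)) (U j) ⟩
      (T i - x * T (1 + i)) * U j
        ≈⟨ *-congʳ (T-in-U i) ⟩
      (1# - x * x) * U i * U j
        ≈⟨ *-assoc _ _ _ ⟩
      (1# - x * x) * (U i * U j) ∎

    -- The second sequence enters only through its values 1 and 2x, so the cancellation is the one
    -- for two copies of `U`.
    TU-UT : ∀ m i j →
      T (suc m + i) * U (suc m + j) - U m * T (suc m + 1 + i + j) ≈ T i * U j
    TU-UT m i j = begin
      _ ≈⟨ product-difference T-solution U-solution m i j ⟩
      U j * (T (1 + i) * U 1 - T (2 + i) * U 0)
        ≈⟨ *-congˡ (-‿cong₂ (*-congˡ U₁) (*-cong (T-solution i) U₀)) ⟩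
      U j * (T (1 + i) * 2x - (2x * T (1 + i) - T i) * 1#)
        ≈⟨ solve 4 (λ t u v w → w :* (v :* t :- (t :* v :- u) :* con (+ 1)) := u :* w)
             refl 2x (T i) (T (1 + i)) (U j) ⟩
      T i * U j ∎

    -- The factor of index `m` is now a `T`, so the two sequences trade places, and `i` and `j` with
    -- them.
    TU-TU : ∀ m i j →
      T (suc m + i) * U (suc m + j) - T m * U (suc m + 1 + i + j) ≈ - (U i * T (j + 2))
    TU-TU m i j = begin
      T (suc m + i) * U (suc m + j) - T m * U (suc m + 1 + i + j)
        ≈⟨ -‿cong₂ (*-comm _ _) (*-congˡ (index U
             (N.solve 3 (λ m i j → N.con 1 N.:+ m N.:+ N.con 1 N.:+ i N.:+ j
               N.:= N.con 1 N.:+ m N.:+ N.con 1 N.:+ j N.:+ i) ≡.refl m i j))) ⟩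
      U (suc m + j) * T (suc m + i) - T m * U (suc m + 1 + j + i)
        ≈⟨ product-difference U-solution T-solution m j i ⟩
      U i * (U (1 + j) * T 1 - U (2 + j) * T 0)
        -- Expanding U(j+2) by `U-suc` instead of the recurrence cancels x U(j+1) and leaves
        -- -T(j+2).
        ≈⟨ *-congˡ (-‿cong₂ (*-congˡ T₁) (*-cong (U-suc (1 + j)) T₀)) ⟩
      U i * (U (1 + j) * x - (x * U (1 + j) ⊹ 1# * T (2 + j)) * 1#)
        ≈⟨ solve 4 (λ x u v w →
             w :* (u :* x :- (x :* u :+ con (+ 1) :* v) :* con (+ 1)) := :- (w :* v))
             refl x (U (1 + j)) (T (2 + j)) (U i) ⟩
      - (U i * T (2 + j))
        ≈⟨ -‿cong (*-congˡ (index T (ℕ.+-comm 2 j))) ⟩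
      - (U i * T (j + 2)) ∎
      where module N = +-*-Solver

    -- Moving the whole index to one side leaves x T(p+q+1) - T(p+q), the negative of the expression
    -- in `T-in-U`.
    TT-difference : ∀ p q →
      T (1 + p) * T (1 + q) - T p * T q ≈ (x * x - 1#) * U (p + q)
    TT-difference p q = begin
      T (1 + p) * T (1 + q) - T p * T q
        ≈⟨ diagonal-difference T-solution T-solution p q ⟩
      T 1 * T (1 + (p + q)) - T 0 * T (p + q)
        ≈⟨ -‿cong₂ (*-congʳ T₁) (*-congʳ T₀) ⟩
      x * T (1 + (p + q)) - 1# * T (p + q)
        ≈⟨ solve 3 (λ x u v → x :* v :- con (+ 1) :* u := :- (u :- x :* v))
             refl x (T (p + q)) (T (1 + (p + q))) ⟩
      - (T (p + q) - x * T (1 + (p + q)))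
        ≈⟨ -‿cong (T-in-U (p + q)) ⟩
      - ((1# - x * x) * U (p + q))
        ≈⟨ solve 2 (λ x u → :- ((con (+ 1) :- x :* x) :* u) := (x :* x :- con (+ 1)) :* u)
             refl x (U (p + q)) ⟩
      (x * x - 1#) * U (p + q) ∎

    -- With the whole index on one side, the difference is exactly the recurrence for U(p+q+2).
    UU-difference : ∀ p q → U (1 + p) * U (1 + q) - U p * U q ≈ U (2 + (p + q))
    UU-difference p q = begin
      U (1 + p) * U (1 + q) - U p * U q
        ≈⟨ diagonal-difference U-solution U-solution p q ⟩
      U 1 * U (1 + (p + q)) - U 0 * U (p + q)
        ≈⟨ -‿cong₂ (*-congʳ U₁) (trans (*-congʳ U₀) (*-identityˡ _)) ⟩
      2x * U (1 + (p + q)) - U (p + q)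
        ≈⟨ U-solution (p + q) ⟨
      U (2 + (p + q)) ∎

    -- Passing from m to m + 1 adds (x² − 1) U (2m + 2 + i + j) to both products.
    TT-UU : ∀ m i j →
      T (suc m + i) * T (suc m + j) - (x * x - 1#) * (U m * U (m + i + j)) ≈ T i * T j
    TT-UU zero i j = begin
      T (1 + i) * T (1 + j) - y * (U 0 * U (i + j))
        ≈⟨ +-congˡ (-‿cong (*-congˡ (trans (*-congʳ U₀) (*-identityˡ _)))) ⟩
      T (1 + i) * T (1 + j) - y * U (i + j)
        -- As `U 0` is 1, the subtracted term is itself a difference of `T` products, and the sum
        -- telescopes.
        ≈⟨ +-congˡ (-‿cong (TT-difference i j)) ⟨
      T (1 + i) * T (1 + j) - (T (1 + i) * T (1 + j) - T i * T j)
        ≈⟨ solve 2 (λ a b → a :- (a :- b) := b) refl _ _ ⟩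
      T i * T j ∎
      where y = x * x - 1#
    TT-UU (suc m) i j = begin
      T (1 + p) * T (1 + q) - y * (U (1 + m) * U (1 + r))
        ≈⟨ solve 5 (λ y a a′ b b′ →
             a′ :- y :* b′ := (a′ :- a) :- y :* (b′ :- b) :+ (a :- y :* b))
             refl y (T p * T q) _ (U m * U r) _ ⟩
      (T (1 + p) * T (1 + q) - T p * T q) - y * (U (1 + m) * U (1 + r) - U m * U r)
        ⊹ (T p * T q - y * (U m * U r))
        ≈⟨ +-cong (-‿cong₂ (TT-difference p q) (*-congˡ (UU-difference m r))) (TT-UU m i j) ⟩
      (y * U (p + q) - y * U (2 + (m + r))) ⊹ T i * T j
        ≈⟨ +-congʳ (+-congʳ (*-congˡ (index U
             (N.solve 3 (λ m i j →
               N.con 1 N.:+ m N.:+ i N.:+ (N.con 1 N.:+ m N.:+ j)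
                 N.:= N.con 2 N.:+ (m N.:+ (m N.:+ i N.:+ j))) ≡.refl m i j)))) ⟩
      (y * U (2 + (m + r)) - y * U (2 + (m + r))) ⊹ T i * T j
        ≈⟨ +-congʳ (-‿inverseʳ _) ⟩
      0# ⊹ T i * T j
        ≈⟨ +-identityˡ _ ⟩
      T i * T j ∎
      where
      module N = +-*-Solver
      y = x * x - 1#
      p = suc m + i
      q = suc m + j
      r = m + i + j

-- Specialisation to the polynomial ring.

theorem2p1 : ∀ {c ℓ : Level} (R : CommutativeRing c ℓ) → let open Polynomials R in
    ∀ (n : ℕ) → 1 ≤ n → ∀ (i j : ℕ) →
    (U (n + i) ⊗ U (n + j) ⊖ U (n ∸ 1) ⊗ U (n + 1 + i + j) ≋ U i ⊗ U j)
    × (T (n + i) ⊗ T (n + j) ⊖ T (n ∸ 1) ⊗ T (n + 1 + i + j) ≋ (𝟙 ⊖ X ⊗ X) ⊗ (U i ⊗ U j))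
    × (T (n + i) ⊗ U (n + j) ⊖ U (n ∸ 1) ⊗ T (n + 1 + i + j) ≋ T i ⊗ U j)
    × (T (n + i) ⊗ U (n + j) ⊖ T (n ∸ 1) ⊗ U (n + 1 + i + j) ≋ ⊝ (U i ⊗ T (j + 2)))
    × (T (n + i) ⊗ T (n + j) ⊖ (X ⊗ X ⊖ 𝟙) ⊗ (U (n ∸ 1) ⊗ U (n ∸ 1 + i + j)) ≋ T i ⊗ T j)
-- The bound `1 ≤ n` leaves only `n = suc m`, for which `n ∸ 1` reduces to `m`.
theorem2p1 R (suc m) _ i j =
  UU-UU m i j , TT-TT m i j , TU-UT m i j , TU-TU m i j , TT-UU m i j
  where
  open Polynomials R
  open PolynomialRing R
  -- The ground ring is now R[x] with `X` as x. Its `2x` unfolds to `2X`, so recurrences and initial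
  -- values hold by reflexivity.
  open ChebyshevRecurrence ⊕-⊗-commutativeRing X
  open Identities {T} {U}
    (λ n → ≋-refl (T (2 + n))) (≋-refl 𝟙) (≋-refl X) (λ n → ≋-refl (U (2 + n))) (≋-refl 𝟙) (≋-refl 2X)
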